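{- Let $\Delta:\mathbb{N}^{(2)}\to[k]$ be surjective and suppose $n$ is a natural number such that $k\geq\binom{n}{2}+1$. Then there exists an $n$-homogeneous tuple with respect to $\Delta$.
   Context: For a set $X$, $X^{(2)}$ denotes the set of unordered pairs of elements of $X$, and $[k]=\{1,\dots,k\}$. A set $X\subset\mathbb{N}$ is $m$-coloured if $\Delta(X^{(2)})$ has exactly $m$ elements. For $v\in\mathbb{N}$ and $X\subset\mathbb{N}\setminus\{v\}$, a colour $c$ is a new colour from $v$ into $X$ if some edge from $v$ to a vertex of $X$ has colour $c$ and no edge in $X^{(2)}$ has colour $c$; $N_{\Delta}(v,X)$ denotes the set of new colours from $v$ into $X$. For an $n$-tuple $\mathbf{X}=(X_1,\dots,X_n)$ write $\bar{X}_i=X_1\cup\dots\cup X_i$. The tuple $\mathbf{X}$, with each $X_i$ a nonempty subset of $\mathbb{N}$, is $n$-homogeneous with respect to $\Delta$ if: (1) $X_i\cap X_j=\emptyset$ for $i\neq j$; (2) $X_1$ is infinite and $1$-coloured; (3) $\Delta(\bar{X}_1^{(2)})\subsetneq\Delta(\bar{X}_2^{(2)})\subsetneq\dots\subsetneq\Delta(\bar{X}_n^{(2)})$; (4) for each $2\leq i\leq n$ and every $v\in X_i$, $N_{\Delta}(v,\bar{X}_{i-1})=\Delta(\bar{X}_i^{(2)})\setminus\Delta(\bar{X}_{i-1}^{(2)})$; (5) $|\Delta(\bar{X}_n^{(2)})|\leq\binom{n}{2}+1$. -}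

module Defs where

open import Data.Nat using (ℕ; zero; suc; _+_; _∸_; _≤_; _<_)
open import Data.Nat.Combinatorics using (_C_)
open import Data.Fin using (Fin)
open import Data.Product using (Σ; ∃; ∃-syntax; _×_; _,_)
open import Relation.Binary.PropositionalEquality using (_≡_; _≢_)
open import Relation.Nullary using (¬_)
open import Function.Bundles using (_⇔_)
open import Function.Definitions using (Injective)
open import Level using (0ℓ)
open import Relation.Unary using (Pred)

SubsetN : Set₁
SubsetN = Pred ℕ 0ℓ

-- A colouring Δ : ℕ^(2) → [k] of unordered pairs is represented by a
-- function on ordered pairs that is symmetric; its values on the
-- diagonal (x , x) are irrelevant and never used.
Symmetric : ∀ {k} → (ℕ → ℕ → Fin k) → Set
Symmetric Δ = ∀ x y → Δ x y ≡ Δ y x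

SurjectiveColouring : ∀ {k} → (ℕ → ℕ → Fin k) → Set
SurjectiveColouring {k} Δ = ∀ (c : Fin k) → ∃[ x ] ∃[ y ] (x ≢ y × Δ x y ≡ c)

Colours : ∀ {k} → (ℕ → ℕ → Fin k) → SubsetN → Pred (Fin k) 0ℓ
Colours Δ X c = ∃[ x ] ∃[ y ] (X x × X y × x ≢ y × Δ x y ≡ c)

HasSize : ∀ {k} → ℕ → Pred (Fin k) 0ℓ → Set
HasSize {k} m S = Σ (Fin m → Fin k) λ f → Injective _≡_ _≡_ f × (∀ c → S c ⇔ (∃[ i ] f i ≡ c))

AtMost : ∀ {k} → ℕ → Pred (Fin k) 0ℓ → Set
AtMost m S = ∃[ j ] (j ≤ m × HasSize j S)

Coloured : ∀ {k} → (ℕ → ℕ → Fin k) → ℕ → SubsetN → Set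
Coloured Δ m X = HasSize m (Colours Δ X)

Infinite : SubsetN → Set
Infinite X = ∀ m → ∃[ x ] (m ≤ x × X x)

Nonempty : SubsetN → Set
Nonempty X = ∃[ x ] X x

NewColours : ∀ {k} → (ℕ → ℕ → Fin k) → ℕ → SubsetN → Pred (Fin k) 0ℓ
NewColours Δ v X c = (∃[ x ] (X x × v ≢ x × Δ v x ≡ c)) × ¬ Colours Δ X c

-- Tuples (X_1, …, X_n) are represented by X : ℕ → SubsetN, only the
-- components with index 1 ≤ i ≤ n being relevant.
Tuple : Set₁
Tuple = ℕ → SubsetN

bar : Tuple → ℕ → SubsetN
bar X i x = ∃[ j ] (1 ≤ j × j ≤ i × X j x)

StrictSub : ∀ {k} → Pred (Fin k) 0ℓ → Pred (Fin k) 0ℓ → Set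
StrictSub A B = (∀ c → A c → B c) × (∃[ c ] (B c × ¬ A c))

Homogeneous : ∀ {k} → (ℕ → ℕ → Fin k) → ℕ → Tuple → Set
Homogeneous Δ n X =
  (∀ i → 1 ≤ i → i ≤ n → Nonempty (X i)) ×
  (∀ i j → 1 ≤ i → i ≤ n → 1 ≤ j → j ≤ n → i ≢ j → ∀ x → X i x → ¬ X j x) ×
  (Infinite (X 1) × Coloured Δ 1 (X 1)) ×
  (∀ i → 1 ≤ i → i < n → StrictSub (Colours Δ (bar X i)) (Colours Δ (bar X (suc i)))) ×
  (∀ i → 2 ≤ i → i ≤ n → ∀ v → X i v → ∀ c →
      NewColours Δ v (bar X (i ∸ 1)) c ⇔ (Colours Δ (bar X i) c × ¬ Colours Δ (bar X (i ∸ 1)) c)) ×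
  AtMost ((n C 2) + 1) (Colours Δ (bar X n))

{-# OPTIONS --safe #-}

-- Ramsey's theorem gives an infinite 1-coloured set H and a finite set W₀ such that
-- H ∪ W₀ has all k colours and every w ∈ W₀ is joined to H in a single colour. Adding a
-- vertex to the union of a tuple satisfying (1)–(4) never shortens the tuple, and lengthens
-- it if the vertex brings new colours. By induction on n, whenever H ∪ W has at least
-- C(n,2) + 1 colours, some W′ ⊆ W carries a tuple of length at least n on H ∪ W′ and at
-- most C(n,2) + 1 colours. For n = m + 1, first shrink W until H ∪ W has more than
-- C(m,2) + 1 but at most C(m+1,2) + 1 colours. The induction hypothesis then yields a tuple
-- of length at least m inside H ∪ W with fewer colours than H ∪ W, so adjoining the
-- remaining vertices lengthens it.
module Submission where

open import Defs
open import Data.Nat using (ℕ; _+_; _≤_)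
open import Data.Nat.Combinatorics using (_C_)
open import Data.Fin using (Fin)
open import Data.Product using (∃-syntax)
open import Level using (0ℓ)
open import Axiom.ExcludedMiddle using (ExcludedMiddle)

open import Algebra.Properties.CommutativeSemigroup using (interchange)
open import Data.Empty using (⊥-elim)
open import Data.Fin using (zero; suc)
open import Data.Fin.Properties using () renaming (suc-injective to fsuc-injective)
open import Data.List.Base using (List; []; _∷_; filter; length; concatMap; allFin)
open import Data.List.Membership.Propositional using (_∈_; find; lose)
open import Data.List.Membership.Propositional.Properties
  using (∈-filter⁺; ∈-filter⁻; ∈-allFin; ∈-concatMap⁺)
open import Data.List.Properties using (filter-notAll)
open import Data.List.Relation.Unary.Any using (here; there; any?)
open import Data.Nat using (zero; suc; _<_; _⊔_; _∸_; z≤n; s≤s; s≤s⁻¹; _≟_; _<?_)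
open import Data.Nat.Combinatorics using (nCk+nC[k+1]≡[n+1]C[k+1]; nC1≡n)
open import Data.Nat.Induction using (<-wellFounded)
open import Data.Nat.Properties
open import Data.Product using (_×_; _,_; proj₁; proj₂)
open import Data.Sum using (_⊎_; inj₁; inj₂; [_,_]; [_,_]′)
open import Data.Unit using (⊤; tt)
open import Function using (_∘_; id)
open import Function.Bundles using (_⇔_; mk⇔; Equivalence)
open import Induction.WellFounded using (Acc; acc)
open import Relation.Binary.Definitions using (tri<; tri≈; tri>)
open import Relation.Binary.PropositionalEquality
  using (_≡_; _≢_; refl; sym; trans; cong; subst)
open import Relation.Nullary using (¬_; Dec; yes; no; ¬?; contradiction)
open import Relation.Unary using (Pred; ∅; ｛_｝; _∪_; _⊆_; _≐_)

-- Preliminaries on sizes, infinite sets, binomial coefficients and deletion from lists.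

HasSize-resp : ∀ {k m} {P Q : Pred (Fin k) 0ℓ} → P ≐ Q → HasSize m P → HasSize m Q
HasSize-resp (P⊆Q , Q⊆P) (f , inj , enum) =
  f , inj , λ c → mk⇔ (Equivalence.to (enum c) ∘ Q⊆P) (P⊆Q ∘ Equivalence.from (enum c))

Infinite-mono : ∀ {A B : SubsetN} → A ⊆ B → Infinite A → Infinite B
Infinite-mono A⊆B inf m = let x , m≤x , Ax = inf m in x , m≤x , A⊆B Ax

upper-bound : ∀ {k} (f : Fin k → ℕ) → ∃[ M ] (∀ i → f i ≤ M)
upper-bound {zero}  f = 0 , λ ()
upper-bound {suc k} f with M , f≤M ← upper-bound (f ∘ suc) =
  f zero ⊔ M , λ { zero → m≤m⊔n _ _ ; (suc i) → ≤-trans (f≤M i) (m≤n⊔m _ _) }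

[1+n]C2 : ∀ n → suc n C 2 ≡ n + n C 2
[1+n]C2 n = trans (sym (nCk+nC[k+1]≡[n+1]C[k+1] n 1)) (cong (_+ n C 2) (nC1≡n n))

-- The index starts at one because C(0,2) = C(1,2) = 0; from there on Pascal's rule adds i + 1 > 0.
C2-increasing : ∀ i → suc i C 2 < suc (suc i) C 2
C2-increasing i = <-≤-trans (m<n+m _ (s≤s z≤n)) (≤-reflexive (sym ([1+n]C2 (suc i))))

remove : ℕ → List ℕ → List ℕ
remove w = filter (λ x → ¬? (x ≟ w))

∈-remove⁺ : ∀ {w x W} → x ∈ W → x ≢ w → x ∈ remove w W
∈-remove⁺ = ∈-filter⁺ _

∈-remove⁻ : ∀ {w x} W → x ∈ remove w W → x ∈ W × x ≢ w
∈-remove⁻ W = ∈-filter⁻ _ {xs = W}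

remove-shorter : ∀ {w W} → w ∈ W → length (remove w W) < length W
remove-shorter {W = W} w∈W = filter-notAll _ W (lose w∈W λ w≢w → w≢w refl)

module _ (em : ExcludedMiddle 0ℓ) where

  byContradiction : {P : Set} → ¬ ¬ P → P
  byContradiction {P} ¬¬p with em {P}
  ... | yes p = p
  ... | no ¬p = ⊥-elim (¬¬p ¬p)

  -- Cardinality of sets of colours

  indicator : {P : Set} → Dec P → ℕ
  indicator (yes _) = 1
  indicator (no _)  = 0

  -- Excluded middle decides membership colour by colour, so arbitrary sets of colours can be
  -- counted and compared. `hasSize` turns the count into an enumeration.
  size : ∀ {k} → Pred (Fin k) 0ℓ → ℕ
  size {zero}  P = 0
  size {suc k} P = indicator (em {P zero}) + size (P ∘ suc)

  indicator-submodular : ∀ {A S P Q : Set} (A? : Dec A) (S? : Dec S) (P? : Dec P) (Q? : Dec Q) →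
    (A → P ⊎ Q) → (S → P) → (S → Q) →
    indicator A? + indicator S? ≤ indicator P? + indicator Q?
  indicator-submodular A? (yes s) (no ¬p) Q? _ s⇒p _ = ⊥-elim (¬p (s⇒p s))
  indicator-submodular A? (yes s) (yes p) (no ¬q) _ _ s⇒q = ⊥-elim (¬q (s⇒q s))
  indicator-submodular (yes a) (yes s) (yes p) (yes q) _ _ _ = ≤-refl
  indicator-submodular (no ¬a) (yes s) (yes p) (yes q) _ _ _ = s≤s z≤n
  indicator-submodular (no ¬a) (no ¬s) P? Q? _ _ _ = z≤n
  indicator-submodular (yes a) (no ¬s) (yes p) Q? _ _ _ = s≤s z≤n
  indicator-submodular (yes a) (no ¬s) (no ¬p) (yes q) _ _ _ = s≤s z≤n
  indicator-submodular (yes a) (no ¬s) (no ¬p) (no ¬q) cover _ _ = ⊥-elim ([ ¬p , ¬q ] (cover a))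

  -- With P ∪ Q for A and P ∩ Q for S this is inclusion-exclusion. The inequality holds at each
  -- single colour and is summed over all of them.
  size-submodular : ∀ {k} (A S P Q : Pred (Fin k) 0ℓ) →
    A ⊆ P ∪ Q → S ⊆ P → S ⊆ Q → size A + size S ≤ size P + size Q
  size-submodular {zero} _ _ _ _ _ _ _ = z≤n
  size-submodular {suc k} A S P Q cover S⊆P S⊆Q = begin
    (a + size (A ∘ suc)) + (s + size (S ∘ suc)) ≡⟨ swap a _ s _ ⟩
    (a + s) + (size (A ∘ suc) + size (S ∘ suc))
      ≤⟨ +-mono-≤ (indicator-submodular em em em em cover S⊆P S⊆Q)
                  (size-submodular (A ∘ suc) (S ∘ suc) (P ∘ suc) (Q ∘ suc) cover S⊆P S⊆Q) ⟩
    (p + q) + (size (P ∘ suc) + size (Q ∘ suc)) ≡⟨ swap p q _ _ ⟩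
    (p + size (P ∘ suc)) + (q + size (Q ∘ suc)) ∎
    where
    open ≤-Reasoning
    swap = interchange +-commutativeSemigroup
    a = indicator (em {A zero})
    s = indicator (em {S zero})
    p = indicator (em {P zero})
    q = indicator (em {Q zero})

  size-∅ : ∀ k → size {k} ∅ ≡ 0
  size-∅ zero = refl
  size-∅ (suc k) with em {∅ {A = Fin (suc k)} zero}
  ... | yes ()
  ... | no _ = size-∅ k

  size-∪ : ∀ {k} (A P Q : Pred (Fin k) 0ℓ) → A ⊆ P ∪ Q → size A ≤ size P + size Q
  size-∪ A P Q cover = ≤-trans (m≤m+n _ _) (size-submodular A ∅ P Q cover (λ ()) (λ ()))

  size-mono : ∀ {k} (P Q : Pred (Fin k) 0ℓ) → P ⊆ Q → size P ≤ size Q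
  size-mono {k} P Q P⊆Q = begin
    size P              ≤⟨ size-∪ P Q ∅ (inj₁ ∘ P⊆Q) ⟩
    size Q + size {k} ∅ ≡⟨ cong (size Q +_) (size-∅ k) ⟩
    size Q + 0          ≡⟨ +-identityʳ _ ⟩
    size Q              ∎
    where open ≤-Reasoning

  indicator-≤1 : ∀ {P : Set} (P? : Dec P) → indicator P? ≤ 1
  indicator-≤1 (yes _) = ≤-refl
  indicator-≤1 (no _)  = z≤n

  indicator-false : ∀ {P : Set} (P? : Dec P) → ¬ P → indicator P? ≤ 0
  indicator-false (yes p) ¬p = ⊥-elim (¬p p)
  indicator-false (no _)  _  = z≤n

  size-singleton : ∀ {k} (c : Fin k) → size ｛ c ｝ ≤ 1
  size-singleton {suc k} zero = +-mono-≤ (indicator-≤1 em)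
    (≤-trans (size-mono {k} _ ∅ λ ()) (≤-reflexive (size-∅ k)))
  size-singleton (suc c) = +-mono-≤ (indicator-false em λ ())
    (≤-trans (size-mono (｛ suc c ｝ ∘ suc) ｛ c ｝ fsuc-injective) (size-singleton c))

  size-∪-singleton : ∀ {k} (A P : Pred (Fin k) 0ℓ) {c} → A ⊆ P ∪ ｛ c ｝ → size A ≤ suc (size P)
  size-∪-singleton A P {c} cover = begin
    size A                ≤⟨ size-∪ A P ｛ c ｝ cover ⟩
    size P + size ｛ c ｝ ≤⟨ +-monoʳ-≤ (size P) (size-singleton c) ⟩
    size P + 1            ≡⟨ +-comm (size P) 1 ⟩
    suc (size P)          ∎
    where open ≤-Reasoning

  size-positive : ∀ {k} (P : Pred (Fin k) 0ℓ) {c} → P c → 1 ≤ size P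
  size-positive P {zero} p with em {P zero}
  ... | yes _ = s≤s z≤n
  ... | no ¬p = ⊥-elim (¬p p)
  size-positive P {suc c} p = ≤-trans (size-positive (P ∘ suc) p) (m≤n+m _ _)

  size-full : ∀ {k} (P : Pred (Fin k) 0ℓ) → (∀ c → P c) → k ≤ size P
  size-full {zero} _ _ = z≤n
  size-full {suc k} P p with em {P zero}
  ... | yes _ = s≤s (size-full (P ∘ suc) (p ∘ suc))
  ... | no ¬p = ⊥-elim (¬p (p zero))

  hasSize : ∀ {k} (P : Pred (Fin k) 0ℓ) → HasSize (size P) P
  hasSize {zero} P = (λ ()) , (λ { {()} }) , λ ()
  hasSize {suc k} P with em {P zero} | hasSize (P ∘ suc)
  ... | yes p | f , inj , enum = g , g-inj , λ c → mk⇔ (to c) (from c)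
    where
    g : Fin (suc (size (P ∘ suc))) → Fin (suc k)
    g zero    = zero
    g (suc i) = suc (f i)
    g-inj : ∀ {i j} → g i ≡ g j → i ≡ j
    g-inj {zero}  {zero}  _  = refl
    g-inj {suc i} {suc j} eq = cong suc (inj (fsuc-injective eq))
    to : ∀ c → P c → ∃[ i ] g i ≡ c
    to zero    _  = zero , refl
    to (suc c) pc = let i , eq = Equivalence.to (enum c) pc in suc i , cong suc eq
    from : ∀ c → ∃[ i ] g i ≡ c → P c
    from .zero    (zero  , refl) = p
    from .(suc _) (suc i , refl) = Equivalence.from (enum (f i)) (i , refl)
  ... | no ¬p | f , inj , enum = suc ∘ f , inj ∘ fsuc-injective , λ c → mk⇔ (to c) (from c)
    where
    to : ∀ c → P c → ∃[ i ] suc (f i) ≡ c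
    to zero    pc = ⊥-elim (¬p pc)
    to (suc c) pc = let i , eq = Equivalence.to (enum c) pc in i , cong suc eq
    from : ∀ c → ∃[ i ] suc (f i) ≡ c → P c
    from .(suc _) (i , refl) = Equivalence.from (enum (f i)) (i , refl)

  -- Ramsey's theorem

  infinite-or-bounded : (X : SubsetN) → Infinite X ⊎ (∃[ m ] ∀ x → X x → x < m)
  infinite-or-bounded X with em {∃[ m ] ∀ x → X x → x < m}
  ... | yes bounded = inj₂ bounded
  ... | no unbounded = inj₁ λ m → byContradiction λ none →
          unbounded (m , λ x Xx → ≰⇒> λ m≤x → none (x , m≤x , Xx))

  abstract
    -- If every class were bounded, the largest of the k bounds would bound X.
    pigeonhole : ∀ {k} {X : SubsetN} → Infinite X → (f : ℕ → Fin k) →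
      ∃[ c ] Infinite (λ x → X x × f x ≡ c)
    pigeonhole {k} {X} inf f = byContradiction λ none →
      let bound : ∀ c → ∃[ m ] ∀ x → X x × f x ≡ c → x < m
          bound c = [ (λ i → ⊥-elim (none (c , i))) , id ] (infinite-or-bounded _)
          M , ≤M = upper-bound (proj₁ ∘ bound)
          x , M≤x , Xx = inf M
      in <⇒≱ (proj₂ (bound (f x)) x (Xx , refl)) (≤-trans (≤M (f x)) M≤x)

  module _ {k : ℕ} (Δ : ℕ → ℕ → Fin k) (Δ-sym : Symmetric Δ) where

    -- Each stage picks a vertex and keeps an infinite set of larger vertices joined to it in one
    -- colour. Infinitely many of the picked vertices share this colour, and they form H.
    ramsey : ∀ {Y : SubsetN} → Infinite Y →
      ∃[ X ] (X ⊆ Y × Infinite X × (∃[ c ] (∀ {d} → Colours Δ X d → c ≡ d)))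
    ramsey {Y} Y-inf =
      H , (λ { (t , refl , _) → stage⊆Y t (head∈ t) }) , H-inf , colour , one-colour
      where
      Stage : Set₁
      Stage = ∃[ Z ] Infinite Z

      top : Stage → ℕ
      top (_ , inf) = proj₁ (inf 0)

      above : Stage → SubsetN
      above s y = proj₁ s y × top s < y

      above-inf : ∀ s → Infinite (above s)
      above-inf s m with y , m⊔≤y , Zy ← proj₂ s (m ⊔ suc (top s)) =
        y , ≤-trans (m≤m⊔n _ _) m⊔≤y , Zy , ≤-trans (m≤n⊔m m _) m⊔≤y

      split : ∀ s → ∃[ c ] Infinite (λ y → above s y × Δ (top s) y ≡ c)
      split s = pigeonhole (above-inf s) (Δ (top s))

      stage : ℕ → Stage
      stage zero    = Y , Y-inf
      stage (suc t) = _ , proj₂ (split (stage t))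

      head : ℕ → ℕ
      head t = top (stage t)

      head∈ : ∀ t → proj₁ (stage t) (head t)
      head∈ t = proj₂ (proj₂ (proj₂ (stage t) 0))

      stage⊆Y : ∀ t {y} → proj₁ (stage t) y → Y y
      stage⊆Y zero    = id
      stage⊆Y (suc t) = stage⊆Y t ∘ proj₁ ∘ proj₁

      -- Stages are nested, so a vertex present at stage u has survived the split made at stage s.
      later : ∀ {s y} u → s < u → proj₁ (stage u) y →
        head s < y × Δ (head s) y ≡ proj₁ (split (stage s))
      later (suc u) s<u ((Zy , h<y) , eq) with m≤n⇒m<n∨m≡n (s≤s⁻¹ s<u)
      ... | inj₁ s<u′ = later u s<u′ Zy
      ... | inj₂ refl = h<y , eq

      t≤head : ∀ t → t ≤ head t
      t≤head zero    = z≤n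
      t≤head (suc t) = ≤-<-trans (t≤head t) (proj₁ (later (suc t) ≤-refl (head∈ (suc t))))

      majority : ∃[ c ] Infinite (λ t → ⊤ × proj₁ (split (stage t)) ≡ c)
      majority = pigeonhole (λ m → m , ≤-refl , tt) (λ t → proj₁ (split (stage t)))

      colour : Fin k
      colour = proj₁ majority

      H : SubsetN
      H x = ∃[ t ] (head t ≡ x × proj₁ (split (stage t)) ≡ colour)

      H-inf : Infinite H
      H-inf m with t , m≤t , _ , eq ← proj₂ majority m =
        head t , ≤-trans m≤t (t≤head t) , t , refl , eq

      one-colour : ∀ {d} → Colours Δ H d → colour ≡ d
      one-colour (_ , _ , (s , refl , s-col) , (t , refl , t-col) , x≢y , eq) with <-cmp s t
      ... | tri< s<t _ _ = trans (sym s-col) (trans (sym (proj₂ (later t s<t (head∈ t)))) eq)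
      ... | tri≈ _ refl _ = ⊥-elim (x≢y refl)
      ... | tri> _ _ t<s =
              trans (sym t-col) (trans (sym (proj₂ (later s t<s (head∈ s)))) (trans (Δ-sym _ _) eq))

    -- One application of `pigeonhole` per vertex of L; what was achieved for a vertex survives the
    -- later passages to subsets.
    refine : ∀ (L : List ℕ) {Y : SubsetN} → Infinite Y →
      ∃[ X ] (X ⊆ Y × Infinite X × (∀ {w} → w ∈ L → ∃[ c ] (∀ {x} → X x → Δ w x ≡ c)))
    refine [] {Y} inf = Y , id , inf , λ ()
    refine (w ∷ L) inf with c , inf′ ← pigeonhole inf (Δ w)
      with X , X⊆ , X-inf , mono ← refine L inf′ =
      X , proj₁ ∘ X⊆ , X-inf ,
      λ { (here refl) → c , proj₂ ∘ X⊆ ; (there w∈L) → mono w∈L }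

    -- Layered sets

    -- The first half of `NewColours`, separated from the condition that the colour be absent from
    -- A.
    Sees : ℕ → SubsetN → Pred (Fin k) 0ℓ
    Sees v A c = ∃[ x ] (A x × v ≢ x × Δ v x ≡ c)

    Sees-mono : ∀ {v A B} → A ⊆ B → Sees v A ⊆ Sees v B
    Sees-mono A⊆B (x , Ax , rest) = x , A⊆B Ax , rest

    Colours-mono : ∀ {A B} → A ⊆ B → Colours Δ A ⊆ Colours Δ B
    Colours-mono A⊆B (x , y , Ax , Ay , rest) = x , y , A⊆B Ax , A⊆B Ay , rest

    Colours-resp : ∀ {A B} → A ≐ B → Colours Δ A ≐ Colours Δ B
    Colours-resp (A⊆B , B⊆A) = Colours-mono A⊆B , Colours-mono B⊆A

    Sees⇒Colours : ∀ {v A B} → B v → A ⊆ B → Sees v A ⊆ Colours Δ B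
    Sees⇒Colours Bv A⊆B (x , Ax , v≢x , eq) = _ , x , Bv , A⊆B Ax , v≢x , eq

    Colours-adjoin : ∀ {u A} → Colours Δ (A ∪ ｛ u ｝) ⊆ Colours Δ A ∪ Sees u A
    Colours-adjoin (x , y , inj₁ Ax   , inj₁ Ay   , x≢y , eq) = inj₁ (x , y , Ax , Ay , x≢y , eq)
    Colours-adjoin (x , y , inj₁ Ax   , inj₂ refl , x≢y , eq) =
      inj₂ (x , Ax , x≢y ∘ sym , trans (Δ-sym _ _) eq)
    Colours-adjoin (x , y , inj₂ refl , inj₁ Ay   , x≢y , eq) = inj₂ (y , Ay , x≢y , eq)
    Colours-adjoin (x , y , inj₂ refl , inj₂ refl , x≢y , eq) = ⊥-elim (x≢y refl)

    -- Chain m B says that B = X₁ ∪ … ∪ Xₘ for a tuple satisfying conditions (1)–(4).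
    -- In (4) only one inclusion is recorded: the other one always holds.
    data Chain : ℕ → SubsetN → Set₁ where
      base  : ∀ {B} → Infinite B → Coloured Δ 1 B → Chain 1 B
      layer : ∀ {m A X B} → Chain m A → Nonempty X → (∀ {x} → A x → ¬ X x) → B ≐ A ∪ X →
        (∀ {v c} → X v → Colours Δ B c → ¬ Colours Δ A c → Sees v A c) →
        ∃[ c ] (Colours Δ B c × ¬ Colours Δ A c) →
        Chain (suc m) B

    Chain-resp : ∀ {m A B} → A ≐ B → Chain m A → Chain m B
    Chain-resp A≐B (base inf col) =
      base (Infinite-mono (proj₁ A≐B) inf) (HasSize-resp (Colours-resp A≐B) col)
    Chain-resp (A⊆B , B⊆A) (layer ch ne dis (to , from) sees (c , Ac , ¬c)) =
      layer ch ne dis (to ∘ B⊆A , A⊆B ∘ from)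
        (λ Xv Bc → sees Xv (Colours-mono B⊆A Bc))
        (c , Colours-mono A⊆B Ac , ¬c)

    -- Every edge gained has u as an endpoint, so u sees each colour gained, which is condition (4)
    -- for the layer {u}.
    add-layer : ∀ {m A u} → Chain m A → ¬ A u → ∃[ c ] (Sees u A c × ¬ Colours Δ A c) →
      Chain (suc m) (A ∪ ｛ u ｝)
    add-layer {u = u} ch ¬Au (c , see , ¬Ac) = layer ch (u , refl) (λ { Ax refl → ¬Au Ax }) (id , id)
      (λ { refl Bc ¬c → [ (λ Ac → ⊥-elim (¬c Ac)) , id ] (Colours-adjoin Bc) })
      (c , Sees⇒Colours (inj₂ refl) inj₁ see , ¬Ac)

    -- A vertex u without new colours joins the topmost layer X of B = A ∪ X unless
    -- it has no new colours into A either, in which case it is absorbed by A, or only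
    -- some of those of X, in which case {u} becomes a layer of its own just below X.
    absorb : ∀ {m B u} → Chain m B → ¬ B u → Sees u B ⊆ Colours Δ B →
      ∃[ m′ ] (m ≤ m′ × Chain m′ (B ∪ ｛ u ｝))
    absorb (base inf col) ¬Bu closed = 1 , ≤-refl ,
      base (Infinite-mono inj₁ inf)
        (HasSize-resp (Colours-mono inj₁ , [ id , closed ] ∘ Colours-adjoin) col)
    absorb {B = B} {u} (layer {m} {A} {X} ch ne dis (to , from) sees (c , Bc , ¬Ac)) ¬Bu closed
      with em {∃[ d ] (Sees u A d × ¬ Colours Δ A d)}
    -- Here A ∪ {u} has the same colours as A, so X still brings `c` and can be put back on top of
    -- the chain obtained recursively.
    ... | no none = let m′ , m≤m′ , ch′ = absorb ch (¬Bu ∘ A⊆B) closed-A in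
      suc m′ , s≤s m≤m′ , layer ch′ ne
        (λ { (inj₁ Ax) Xx → dis Ax Xx ; (inj₂ refl) Xu → ¬Bu (from (inj₂ Xu)) })
        (to′ , from′)
        (λ Xv B′d ¬A′d → Sees-mono inj₁ (sees Xv (shrink B′d) (¬A′d ∘ Colours-mono inj₁)))
        (c , Colours-mono inj₁ Bc , ¬Ac ∘ [ id , closed-A ] ∘ Colours-adjoin)
      where
      A⊆B : A ⊆ B
      A⊆B = from ∘ inj₁
      closed-A : Sees u A ⊆ Colours Δ A
      closed-A see = byContradiction λ ¬Ad → none (_ , see , ¬Ad)
      shrink : Colours Δ (B ∪ ｛ u ｝) ⊆ Colours Δ B
      shrink = [ id , closed ] ∘ Colours-adjoin
      to′ : B ∪ ｛ u ｝ ⊆ (A ∪ ｛ u ｝) ∪ X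
      to′ (inj₁ Bx) = [ inj₁ ∘ inj₁ , inj₂ ] (to Bx)
      to′ (inj₂ eq) = inj₁ (inj₂ eq)
      from′ : (A ∪ ｛ u ｝) ∪ X ⊆ B ∪ ｛ u ｝
      from′ = [ [ inj₁ ∘ A⊆B , inj₂ ] , inj₁ ∘ from ∘ inj₂ ]
    ... | yes new with em {∃[ d ] (Colours Δ B d × ¬ Colours Δ A d × ¬ Sees u A d)}
    ... | no none = suc m , ≤-refl , layer ch (proj₁ ne , inj₁ (proj₂ ne))
        (λ { Ax (inj₁ Xx) → dis Ax Xx ; Ax (inj₂ refl) → ¬Bu (from (inj₁ Ax)) })
        (to′ , from′)
        (λ { (inj₁ Xv) B′d ¬Ad → sees Xv (shrink B′d) ¬Ad
           ; (inj₂ refl) B′d ¬Ad → byContradiction λ ¬see → none (_ , shrink B′d , ¬Ad , ¬see) })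
        (c , Colours-mono inj₁ Bc , ¬Ac)
      where
      shrink : Colours Δ (B ∪ ｛ u ｝) ⊆ Colours Δ B
      shrink = [ id , closed ] ∘ Colours-adjoin
      to′ : B ∪ ｛ u ｝ ⊆ A ∪ (X ∪ ｛ u ｝)
      to′ (inj₁ Bx) = [ inj₁ , inj₂ ∘ inj₁ ] (to Bx)
      to′ (inj₂ eq) = inj₂ (inj₂ eq)
      from′ : A ∪ (X ∪ ｛ u ｝) ⊆ B ∪ ｛ u ｝
      from′ = [ inj₁ ∘ from ∘ inj₁ , [ inj₁ ∘ from ∘ inj₂ , inj₂ ] ]
    -- The colour `d` occurs in B but not in A ∪ {u}, so X still brings a new colour once {u} has
    -- been put below it.
    ... | yes (d , Bd , ¬Ad , ¬see) = suc (suc m) , n≤1+n _ ,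
      layer (add-layer ch (¬Bu ∘ A⊆B) new) ne
        (λ { (inj₁ Ax) Xx → dis Ax Xx ; (inj₂ refl) Xu → ¬Bu (from (inj₂ Xu)) })
        (to′ , from′)
        (λ Xv B′d ¬A′d → Sees-mono inj₁ (sees Xv (shrink B′d) (¬A′d ∘ Colours-mono inj₁)))
        (d , Colours-mono inj₁ Bd , [ ¬Ad , ¬see ] ∘ Colours-adjoin)
      where
      A⊆B : A ⊆ B
      A⊆B = from ∘ inj₁
      shrink : Colours Δ (B ∪ ｛ u ｝) ⊆ Colours Δ B
      shrink = [ id , closed ] ∘ Colours-adjoin
      to′ : B ∪ ｛ u ｝ ⊆ (A ∪ ｛ u ｝) ∪ X
      to′ (inj₁ Bx) = [ inj₁ ∘ inj₁ , inj₂ ] (to Bx)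
      to′ (inj₂ eq) = inj₁ (inj₂ eq)
      from′ : (A ∪ ｛ u ｝) ∪ X ⊆ B ∪ ｛ u ｝
      from′ = [ [ inj₁ ∘ A⊆B , inj₂ ] , inj₁ ∘ from ∘ inj₂ ]

    -- The last component says that new colours force a longer chain. In this form the property
    -- composes along a list of vertices.
    Grows : ℕ → SubsetN → SubsetN → Set₁
    Grows m B B′ = ∃[ m′ ] (m ≤ m′ × Chain m′ B′ × (m < m′ ⊎ Colours Δ B′ ⊆ Colours Δ B))

    -- A vertex with a new colour becomes the top layer; any other vertex leaves the set of colours
    -- unchanged.
    adjoin : ∀ {m B} u → Chain m B → Grows m B (B ∪ ｛ u ｝)
    adjoin {m} {B} u ch with em {B u}
    ... | yes Bu = m , ≤-refl , Chain-resp (inj₁ , shrink) ch , inj₂ (Colours-mono shrink)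
      where
      shrink : B ∪ ｛ u ｝ ⊆ B
      shrink = [ id , (λ { refl → Bu }) ]
    ... | no ¬Bu with em {∃[ c ] (Sees u B c × ¬ Colours Δ B c)}
    ... | yes new = suc m , n≤1+n m , add-layer ch ¬Bu new , inj₁ ≤-refl
    ... | no none = let m′ , m≤m′ , ch′ = absorb ch ¬Bu closed in
      m′ , m≤m′ , ch′ , inj₂ ([ id , closed ] ∘ Colours-adjoin)
      where
      closed : Sees u B ⊆ Colours Δ B
      closed see = byContradiction λ ¬Bc → none (_ , see , ¬Bc)

    adjoin-list : ∀ {m B} L → Chain m B → Grows m B (B ∪ (_∈ L))
    adjoin-list {m} {B} [] ch = m , ≤-refl , Chain-resp (inj₁ , shrink) ch , inj₂ (Colours-mono shrink)
      where
      shrink : B ∪ (_∈ []) ⊆ B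
      shrink = [ id , (λ ()) ]
    adjoin-list {m} {B} (u ∷ L) ch
      with m₁ , m≤m₁ , ch₁ , grow₁ ← adjoin u ch
      with m₂ , m₁≤m₂ , ch₂ , grow₂ ← adjoin-list L ch₁ =
      m₂ , ≤-trans m≤m₁ m₁≤m₂ , Chain-resp (to , from) ch₂ , grow grow₁ grow₂
      where
      to : (B ∪ ｛ u ｝) ∪ (_∈ L) ⊆ B ∪ (_∈ (u ∷ L))
      to = [ [ inj₁ , inj₂ ∘ here ∘ sym ] , inj₂ ∘ there ]
      from : B ∪ (_∈ (u ∷ L)) ⊆ (B ∪ ｛ u ｝) ∪ (_∈ L)
      from (inj₁ Bx)          = inj₁ (inj₁ Bx)
      from (inj₂ (here refl)) = inj₁ (inj₂ refl)
      from (inj₂ (there x∈L)) = inj₂ x∈L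
      grow : (m < m₁ ⊎ Colours Δ (B ∪ ｛ u ｝) ⊆ Colours Δ B) →
        (m₁ < m₂ ⊎ Colours Δ ((B ∪ ｛ u ｝) ∪ (_∈ L)) ⊆ Colours Δ (B ∪ ｛ u ｝)) →
        m < m₂ ⊎ Colours Δ (B ∪ (_∈ (u ∷ L))) ⊆ Colours Δ B
      grow (inj₁ m<m₁) _ = inj₁ (<-≤-trans m<m₁ m₁≤m₂)
      grow (inj₂ _) (inj₁ m₁<m₂) = inj₁ (≤-<-trans m≤m₁ m₁<m₂)
      grow (inj₂ old₁) (inj₂ old₂) = inj₂ (old₁ ∘ old₂ ∘ Colours-mono from)

    -- Removing the top layer of a chain leaves a chain. This corrects the excess length that
    -- splitting layers in `absorb` can produce.
    truncate : ∀ {n m B} → 1 ≤ n → n ≤ m → Chain m B → ∃[ A ] (A ⊆ B × Chain n A)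
    truncate (s≤s z≤n) (s≤s z≤n) ch@(base _ _) = _ , id , ch
    truncate 1≤n n≤m ch@(layer ch′ _ _ (_ , from) _ _) with m≤n⇒m<n∨m≡n n≤m
    ... | inj₂ refl = _ , id , ch
    ... | inj₁ n<m with A , A⊆ , chA ← truncate 1≤n (s≤s⁻¹ n<m) ch′ =
      A , from ∘ inj₁ ∘ A⊆ , chA

    -- The same set presented as a tuple

    -- The field `range` makes the components outside 1, ..., m empty, so a further layer can be
    -- entered at index m + 1 without meeting an older one.
    record Layers (m : ℕ) (B : SubsetN) : Set₁ where
      field
        X          : Tuple
        range      : ∀ {i x} → X i x → 1 ≤ i × i ≤ m
        nonempty   : ∀ i → 1 ≤ i → i ≤ m → Nonempty (X i)
        disjoint   : ∀ {i j} → i ≢ j → ∀ x → X i x → ¬ X j x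
        infinite   : Infinite (X 1)
        coloured   : Coloured Δ 1 (X 1)
        increasing : ∀ i → 1 ≤ i → i < m →
          StrictSub (Colours Δ (bar X i)) (Colours Δ (bar X (suc i)))
        new        : ∀ i → 2 ≤ i → i ≤ m → ∀ v → X i v → ∀ c →
          NewColours Δ v (bar X (i ∸ 1)) c ⇔
          (Colours Δ (bar X i) c × ¬ Colours Δ (bar X (i ∸ 1)) c)
        cover      : bar X m ≐ B

    StrictSub-resp : ∀ {A B A′ B′ : Pred (Fin k) 0ℓ} → A ≐ A′ → B ≐ B′ →
      StrictSub A B → StrictSub A′ B′
    StrictSub-resp (A⊆ , ⊆A) (B⊆ , ⊆B) (sub , c , Bc , ¬Ac) =
      (λ d → B⊆ ∘ sub d ∘ ⊆A) , c , B⊆ Bc , ¬Ac ∘ ⊆A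

    NewColours-resp : ∀ {v A B A′ B′ c} → A ≐ A′ → B ≐ B′ →
      NewColours Δ v A c ⇔ (Colours Δ B c × ¬ Colours Δ A c) →
      NewColours Δ v A′ c ⇔ (Colours Δ B′ c × ¬ Colours Δ A′ c)
    NewColours-resp (A⊆ , ⊆A) (B⊆ , ⊆B) iff = mk⇔
      (λ { (see , ¬c) →
           Colours-mono B⊆ (proj₁ (Equivalence.to iff (Sees-mono ⊆A see , ¬c ∘ Colours-mono A⊆))) , ¬c })
      (λ { (Bc , ¬c) →
           Sees-mono A⊆ (proj₁ (Equivalence.from iff (Colours-mono ⊆B Bc , ¬c ∘ Colours-mono A⊆))) , ¬c })

    layers : ∀ {m B} → Chain m B → Layers m B
    layers {B = B} (base inf col) = record
      { X          = λ i x → i ≡ 1 × B x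
      ; range      = λ { (refl , _) → ≤-refl , ≤-refl }
      ; nonempty   = λ { .1 (s≤s z≤n) (s≤s z≤n) → let x , _ , Bx = inf 0 in x , refl , Bx }
      ; disjoint   = λ { i≢j x (refl , _) (refl , _) → i≢j refl }
      ; infinite   = Infinite-mono (refl ,_) inf
      ; coloured   = HasSize-resp (Colours-resp ((refl ,_) , proj₂)) col
      ; increasing = λ { i 1≤i i<1 → contradiction i<1 (≤⇒≯ 1≤i) }
      ; new        = λ { i 2≤i i≤1 → contradiction i≤1 (<⇒≱ 2≤i) }
      ; cover      = (λ { (_ , _ , _ , _ , Bx) → Bx }) , λ Bx → 1 , ≤-refl , ≤-refl , refl , Bx
      }
    layers {B = B} (layer {m} {A} {Y} ch ne dis (to , from) sees strict) = record
      { X          = X⁺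
      ; range      = λ { (inj₁ Xx) → proj₁ (range Xx) , m≤n⇒m≤1+n (proj₂ (range Xx))
                       ; (inj₂ (refl , _)) → s≤s z≤n , ≤-refl }
      ; nonempty   = nonempty⁺
      ; disjoint   = disjoint⁺
      ; infinite   = Infinite-mono inj₁ infinite
      ; coloured   = HasSize-resp (Colours-resp (X≐ 1≤m)) coloured
      ; increasing = increasing⁺
      ; new        = new⁺
      ; cover      = cover⁺
      }
      where
      open Layers (layers ch)

      X⁺ : Tuple
      X⁺ i x = X i x ⊎ (i ≡ suc m × Y x)

      1≤m : 1 ≤ m
      -- The infinite set X 1 has an element, and `range` then bounds the index 1 by m.
      1≤m = proj₂ (range (proj₂ (proj₂ (infinite 0))))

      X≐ : ∀ {i} → i ≤ m → X i ≐ X⁺ i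
      X≐ i≤m = inj₁ , λ { (inj₁ Xx) → Xx ; (inj₂ (refl , _)) → contradiction i≤m 1+n≰n }

      bar≐ : ∀ {i} → i ≤ m → bar X i ≐ bar X⁺ i
      bar≐ i≤m = (λ { (j , 1≤j , j≤i , Xx) → j , 1≤j , j≤i , inj₁ Xx }) ,
        λ { (j , 1≤j , j≤i , Xx) → j , 1≤j , j≤i , proj₂ (X≐ (≤-trans j≤i i≤m)) Xx }

      coverA : A ≐ bar X⁺ m
      coverA = proj₁ (bar≐ ≤-refl) ∘ proj₂ cover , proj₁ cover ∘ proj₂ (bar≐ ≤-refl)

      inA : ∀ {i x} → X i x → A x
      inA Xx = proj₁ cover (_ , proj₁ (range Xx) , proj₂ (range Xx) , Xx)

      cover⁺ : bar X⁺ (suc m) ≐ B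
      cover⁺ = (λ { (_ , _ , _ , inj₁ Xx) → from (inj₁ (inA Xx))
                  ; (_ , _ , _ , inj₂ (_ , Yx)) → from (inj₂ Yx) }) ,
        λ Bx → [ (λ Ax → let j , 1≤j , j≤m , Xx = proj₂ cover Ax
                         in j , 1≤j , m≤n⇒m≤1+n j≤m , inj₁ Xx)
               , (λ Yx → suc m , s≤s z≤n , ≤-refl , inj₂ (refl , Yx)) ]′ (to Bx)

      ⁺cover : B ≐ bar X⁺ (suc m)
      ⁺cover = proj₂ cover⁺ , proj₁ cover⁺

      nonempty⁺ : ∀ i → 1 ≤ i → i ≤ suc m → Nonempty (X⁺ i)
      nonempty⁺ i 1≤i i≤1+m with m≤n⇒m<n∨m≡n i≤1+m
      ... | inj₁ i≤m = let x , Xx = nonempty i 1≤i (s≤s⁻¹ i≤m) in x , inj₁ Xx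
      ... | inj₂ i≡1+m = let x , Yx = ne in x , inj₂ (i≡1+m , Yx)

      disjoint⁺ : ∀ {i j} → i ≢ j → ∀ x → X⁺ i x → ¬ X⁺ j x
      disjoint⁺ i≢j x (inj₁ Xx) (inj₁ Xx′) = disjoint i≢j x Xx Xx′
      disjoint⁺ i≢j x (inj₁ Xx) (inj₂ (_ , Yx)) = dis (inA Xx) Yx
      disjoint⁺ i≢j x (inj₂ (_ , Yx)) (inj₁ Xx) = dis (inA Xx) Yx
      disjoint⁺ i≢j x (inj₂ (refl , _)) (inj₂ (refl , _)) = i≢j refl

      increasing⁺ : ∀ i → 1 ≤ i → i < suc m →
        StrictSub (Colours Δ (bar X⁺ i)) (Colours Δ (bar X⁺ (suc i)))
      increasing⁺ i 1≤i i<1+m with m≤n⇒m<n∨m≡n (s≤s⁻¹ i<1+m)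
      ... | inj₁ i<m = StrictSub-resp (Colours-resp (bar≐ (<⇒≤ i<m))) (Colours-resp (bar≐ i<m))
                         (increasing i 1≤i i<m)
      ... | inj₂ refl = StrictSub-resp (Colours-resp coverA) (Colours-resp ⁺cover)
                          ((λ _ → Colours-mono (from ∘ inj₁)) , strict)

      new⁺ : ∀ i → 2 ≤ i → i ≤ suc m → ∀ v → X⁺ i v → ∀ c →
        NewColours Δ v (bar X⁺ (i ∸ 1)) c ⇔
        (Colours Δ (bar X⁺ i) c × ¬ Colours Δ (bar X⁺ (i ∸ 1)) c)
      new⁺ i 2≤i i≤1+m v (inj₁ Xv) c =
        let i≤m = proj₂ (range Xv)
        in NewColours-resp (bar≐ (≤-trans (m∸n≤m i 1) i≤m)) (bar≐ i≤m) (new i 2≤i i≤m v Xv c)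
      new⁺ i 2≤i i≤1+m v (inj₂ (refl , Yv)) c = NewColours-resp coverA ⁺cover (mk⇔
        -- The inclusion that `Chain` does not record: v lies in B, hence so do its edges into A.
        (λ { (see , ¬Ac) → Sees⇒Colours (from (inj₂ Yv)) (from ∘ inj₁) see , ¬Ac })
        (λ { (Bc , ¬Ac) → sees Yv Bc ¬Ac , ¬Ac }))

    -- Choosing the number of colours

    module _ (H : SubsetN) (H-inf : Infinite H) (h : Fin k) (H-colour : Colours Δ H ⊆ ｛ h ｝) where

      Monochromatic : ℕ → Set
      Monochromatic w = ∃[ c ] (∀ {x} → H x → Δ w x ≡ c)

      extend : List ℕ → SubsetN
      extend W = H ∪ (_∈ W)

      extend-mono : ∀ {W W′} → (∀ {x} → x ∈ W → x ∈ W′) → extend W ⊆ extend W′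
      extend-mono W⊆W′ = [ inj₁ , inj₂ ∘ W⊆W′ ]

      count : List ℕ → ℕ
      count W = size (Colours Δ (extend W))

      -- An infinite set contains two distinct vertices, so H has an edge, whose colour must be h.
      H-colours : Colours Δ H h
      H-colours with H-inf 0
      ... | x , _ , Hx with H-inf (suc x)
      ... | y , x<y , Hy with edge ← (x , y , Hx , Hy , <⇒≢ x<y , refl) =
        subst (Colours Δ H) (sym (H-colour edge)) edge

      count-positive : ∀ W → 1 ≤ count W
      count-positive W = size-positive (Colours Δ (extend W)) (Colours-mono inj₁ H-colours)

      count-[] : count [] ≤ 1
      count-[] = ≤-trans
        (size-mono _ ｛ h ｝ (λ c → H-colour (Colours-mono [ id , (λ ()) ] c)))
        (size-singleton h)

      extend-remove : ∀ {W w x} → extend W x → x ≢ w → extend (remove w W) x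
      extend-remove (inj₁ Hx)  x≢w = inj₁ Hx
      extend-remove (inj₂ x∈W) x≢w = inj₂ (∈-remove⁺ x∈W x≢w)

      -- With no other vertex left in W, the edges at w all run into H and share one colour.
      remove-single : ∀ {W w} → Monochromatic w → remove w W ≡ [] →
        count W ≤ suc (count (remove w W))
      remove-single {W} {w} (c , mono) empty = size-∪-singleton _ _ cover
        where
        in-H : ∀ {x} → extend W x → x ≢ w → H x
        in-H Wx x≢w = [ id , (λ x∈ → contradiction (subst (_ ∈_) empty x∈) λ ()) ]
          (extend-remove Wx x≢w)
        cover : Colours Δ (extend W) ⊆ Colours Δ (extend (remove w W)) ∪ ｛ c ｝
        cover (x , y , Wx , Wy , x≢y , eq) with x ≟ w | y ≟ w
        ... | yes refl | yes refl = contradiction refl x≢y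
        ... | yes refl | no y≢w   = inj₂ (trans (sym (mono (in-H Wy y≢w))) eq)
        ... | no x≢w   | yes refl =
          inj₂ (trans (sym (mono (in-H Wx x≢w))) (trans (Δ-sym _ _) eq))
        ... | no x≢w   | no y≢w   =
          inj₁ (x , y , extend-remove Wx x≢w , extend-remove Wy y≢w , x≢y , eq)

      -- Only the colour of the edge w w′ can be lost both by removing w and by removing w′.
      remove-submodular : ∀ W {w w′} → w′ ≢ w →
        count W + count (remove w′ (remove w W)) ≤ suc (count (remove w W)) + count (remove w′ W)
      remove-submodular W {w} {w′} w′≢w = begin
        count W + count (remove w′ (remove w W))
          ≤⟨ size-submodular _ _ (Colours Δ (extend (remove w W)) ∪ ｛ Δ w w′ ｝) _ cover
               (inj₁ ∘ Colours-mono (extend-mono (proj₁ ∘ ∈-remove⁻ (remove w W))))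
               (Colours-mono (extend-mono λ x∈ →
                 let x∈′ , x≢w′ = ∈-remove⁻ (remove w W) x∈
                 in ∈-remove⁺ (proj₁ (∈-remove⁻ W x∈′)) x≢w′)) ⟩
        size (Colours Δ (extend (remove w W)) ∪ ｛ Δ w w′ ｝) + count (remove w′ W)
          ≤⟨ +-monoˡ-≤ _ (size-∪-singleton _ (Colours Δ (extend (remove w W))) id) ⟩
        suc (count (remove w W)) + count (remove w′ W) ∎
        where
        open ≤-Reasoning
        cover : Colours Δ (extend W) ⊆
          (Colours Δ (extend (remove w W)) ∪ ｛ Δ w w′ ｝) ∪ Colours Δ (extend (remove w′ W))
        cover (x , y , Wx , Wy , x≢y , eq) with x ≟ w | y ≟ w | x ≟ w′ | y ≟ w′
        -- An edge avoiding w or avoiding w′ survives the corresponding deletion; otherwise it is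
        -- the edge from w to w′.
        ... | no x≢w | no y≢w | _ | _ =
          inj₁ (inj₁ (x , y , extend-remove Wx x≢w , extend-remove Wy y≢w , x≢y , eq))
        ... | _ | _ | no x≢w′ | no y≢w′ =
          inj₂ (x , y , extend-remove Wx x≢w′ , extend-remove Wy y≢w′ , x≢y , eq)
        ... | yes refl | _ | _ | yes refl = inj₁ (inj₂ eq)
        ... | _ | yes refl | yes refl | _ = inj₁ (inj₂ (trans (Δ-sym _ _) eq))
        ... | yes refl | _ | yes refl | no y≢w′ = contradiction refl w′≢w
        ... | no x≢w | yes refl | no x≢w′ | yes refl = contradiction refl w′≢w

      -- This acts like a minimum degree: by `Lossy-remove` it drops by at most one when a vertex is
      -- deleted, which drives the induction in `Lossy-bound`.
      Lossy : ℕ → List ℕ → Set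
      Lossy j W = ∀ {w} → w ∈ W → j + count (remove w W) ≤ count W

      -- By `remove-submodular`, deleting w lowers the cost of w′ by at most one. Adding `suc b` to
      -- both sides avoids subtraction.
      Lossy-remove : ∀ {j W w} → w ∈ W → Lossy (suc j) W → Lossy j (remove w W)
      Lossy-remove {j} {W} {w} w∈W lossy {w′} w′∈ = +-cancelʳ-≤ (suc (count (remove w′ W))) _ _ (begin
        j + s + suc b       ≡⟨ +-suc (j + s) b ⟩
        suc (j + s + b)     ≡⟨ cong suc (+-assoc j s b) ⟩
        suc (j + (s + b))   ≡⟨ cong (λ z → suc (j + z)) (+-comm s b) ⟩
        suc (j + (b + s))   ≡⟨ cong suc (sym (+-assoc j b s)) ⟩
        suc j + b + s       ≤⟨ +-monoˡ-≤ s (lossy (proj₁ (∈-remove⁻ W w′∈))) ⟩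
        count W + s         ≤⟨ remove-submodular W (proj₂ (∈-remove⁻ W w′∈)) ⟩
        suc (count (remove w W)) + b ≡⟨ sym (+-suc _ b) ⟩
        count (remove w W) + suc b ∎)
        where
        open ≤-Reasoning
        s = count (remove w′ (remove w W))
        b = count (remove w′ W)

      -- Were w the only vertex of W, deleting it would cost at most one colour, whereas at least
      -- two are lost.
      remove-nonempty : ∀ {i W w} → Monochromatic w → w ∈ W → Lossy (2 + i) W →
        ∃[ w′ ] w′ ∈ remove w W
      remove-nonempty {W = W} {w} mono w∈W lossy with remove w W in eq
      ... | w′ ∷ _ = w′ , here refl
      ... | [] = contradiction (≤-trans (lossy w∈W) (remove-single mono eq))
                               (<⇒≱ (s≤s (m<n+m _ (s≤s z≤n))))

      -- Successive deletions cost at least j, j - 1, ..., 1 colours, in total C(j+1,2), and at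
      -- least the colour of H remains.
      Lossy-bound : ∀ j {W w} → (∀ {x} → x ∈ W → Monochromatic x) → w ∈ W → Lossy j W →
        suc (suc j C 2) ≤ count W
      Lossy-bound zero {W} _ _ _ = count-positive W
      -- Deleting w may exhaust W here, so the count of what remains is bounded by the colour of H
      -- alone.
      Lossy-bound (suc zero) {W} {w} _ w∈W lossy =
        ≤-trans (s≤s (count-positive (remove w W))) (lossy w∈W)
      Lossy-bound (suc (suc i)) {W} {w} mono w∈W lossy = begin
        suc ((3 + i) C 2)              ≡⟨ cong suc ([1+n]C2 (2 + i)) ⟩
        suc ((2 + i) + (2 + i) C 2)    ≡⟨ sym (+-suc (2 + i) _) ⟩
        (2 + i) + suc ((2 + i) C 2)
          ≤⟨ +-monoʳ-≤ (2 + i) (Lossy-bound (suc i) (mono ∘ proj₁ ∘ ∈-remove⁻ W)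
               (proj₂ (remove-nonempty (mono w∈W) w∈W lossy)) (Lossy-remove w∈W lossy)) ⟩
        (2 + i) + count (remove w W)   ≤⟨ lossy w∈W ⟩
        count W                        ∎
        where open ≤-Reasoning

      -- Delete vertices while more than 1 + C(m,2) colours survive. Were the end result W to
      -- have too many colours, every vertex of W would cost at least m + 1 of them, so that
      -- by Lossy-bound yet another vertex could have been deleted.
      few-colours : ∀ i W → let m = suc i in
        (∀ {x} → x ∈ W → Monochromatic x) → suc (m C 2) < count W → Acc _<_ (length W) →
        ∃[ W′ ] ((∀ {x} → x ∈ W′ → x ∈ W) × suc (m C 2) < count W′ × count W′ ≤ suc (suc m C 2))
      few-colours i W mono many (acc rec) with any? (λ w → suc (suc i C 2) <? count (remove w W)) W
      ... | yes some
        with w , w∈W , many′ ← find some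
        with W′ , W′⊆ , ans ← few-colours i (remove w W) (mono ∘ proj₁ ∘ ∈-remove⁻ W) many′
                                (rec (remove-shorter w∈W)) =
        W′ , proj₁ ∘ ∈-remove⁻ W ∘ W′⊆ , ans
      -- Only H is left, and its single colour contradicts `many`.
      few-colours i [] mono many _ | no _ =
        contradiction (≤-trans many count-[]) λ { (s≤s ()) }
      few-colours i W@(w ∷ _) mono many _ | no none = W , id , many , ≮⇒≥ ¬excess
        where
        m = suc i
        module _ (excess : suc (suc m C 2) < count W) where
          open ≤-Reasoning
          lossy : Lossy (suc m) W
          -- A deletion leaves at most C(m,2) + 1 colours, while W has at least C(m+1,2) + 2 = m +
          -- C(m,2) + 2; the difference is m + 1.
          lossy {w} w∈W = begin
            suc m + count (remove w W) ≤⟨ +-monoʳ-≤ (suc m) (≮⇒≥ (none ∘ lose w∈W)) ⟩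
            suc m + suc (m C 2)        ≡⟨ cong suc (+-suc m _) ⟩
            suc (suc (m + m C 2))      ≡⟨ cong (λ z → suc (suc z)) (sym ([1+n]C2 m)) ⟩
            suc (suc (suc m C 2))      ≤⟨ excess ⟩
            count W                    ∎
          still-many : suc (m C 2) < count (remove w W)
          -- After deleting w each further deletion still costs m colours, so `Lossy-bound` gives
          -- C(m+1,2) + 1 colours, and C(m+1,2) > C(m,2) since m is positive.
          still-many = begin-strict
            suc (m C 2)         <⟨ s≤s (C2-increasing i) ⟩
            suc (suc m C 2)
              ≤⟨ Lossy-bound m (mono ∘ proj₁ ∘ ∈-remove⁻ W)
                   (proj₂ (remove-nonempty (mono (here refl)) (here refl) lossy))
                   (Lossy-remove (here refl) lossy) ⟩
            count (remove w W)  ∎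
        ¬excess : ¬ (suc (suc m C 2) < count W)
        ¬excess excess = none (lose (here refl) (still-many excess))

      chain-with-few-colours : ∀ i W → let n = suc i in
        (∀ {x} → x ∈ W → Monochromatic x) → suc (n C 2) ≤ count W →
        ∃[ W′ ] ∃[ m ] ((∀ {x} → x ∈ W′ → x ∈ W) × n ≤ m × Chain m (extend W′) ×
          count W′ ≤ suc (n C 2))
      chain-with-few-colours zero W mono many =
        -- For n = 1 the set H itself is a chain of length one.
        [] , 1 , (λ ()) , ≤-refl , Chain-resp (inj₁ , [ id , (λ ()) ]) (base H-inf single) , count-[]
        where
        single : Coloured Δ 1 H
        single = (λ _ → h) , (λ { {zero} {zero} _ → refl }) ,
          λ c → mk⇔ (λ Hc → zero , H-colour Hc) (λ { (_ , refl) → H-colours })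
      chain-with-few-colours (suc i) W mono many
        with W₁ , W₁⊆W , many₁ , few₁ ← few-colours i W mono (≤-trans (s≤s (C2-increasing i)) many) (<-wellFounded _)
        with W₂ , m , W₂⊆W₁ , n≤m , ch , few₂ ←
          chain-with-few-colours i W₁ (mono ∘ W₁⊆W) (<⇒≤ many₁)
        with m′ , m≤m′ , ch′ , grow ← adjoin-list W₁ ch =
        W₁ , m′ , W₁⊆W , ≤-trans (s≤s n≤m) (longer grow) , Chain-resp (to , from) ch′ , few₁
        where
        to : extend W₂ ∪ (_∈ W₁) ⊆ extend W₁
        to = [ extend-mono W₂⊆W₁ , inj₂ ]
        from : extend W₁ ⊆ extend W₂ ∪ (_∈ W₁)
        from = [ inj₁ ∘ inj₁ , inj₂ ]
        -- The chain on H ∪ W₂ has at most C(i+1,2) + 1 colours and H ∪ W₁ has more, so the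
        -- alternative without new colours is impossible.
        longer : m < m′ ⊎ Colours Δ (extend W₂ ∪ (_∈ W₁)) ⊆ Colours Δ (extend W₂) → m < m′
        longer (inj₁ m<m′) = m<m′
        longer (inj₂ old) = contradiction
          (≤-trans (size-mono (Colours Δ (extend W₁)) (Colours Δ (extend W₂)) (old ∘ Colours-mono from)) few₂) (<⇒≱ many₁)

-- A finite vertex set spanning all colours, and the proof of the theorem.

endpoints : ∀ {k} {Δ : ℕ → ℕ → Fin k} → SurjectiveColouring Δ → List ℕ
endpoints {k} surj = concatMap (λ c → let x , y , _ = surj c in x ∷ y ∷ []) (allFin k)

endpoints-colours : ∀ {k} {Δ : ℕ → ℕ → Fin k} (surj : SurjectiveColouring Δ) →
  ∀ c → Colours Δ (_∈ endpoints surj) c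
endpoints-colours surj c = let x , y , x≢y , eq = surj c in
  x , y , ∈-concatMap⁺ _ (lose (∈-allFin c) (here refl)) ,
  ∈-concatMap⁺ _ (lose (∈-allFin c) (there (here refl))) , x≢y , eq

theorem6 : ExcludedMiddle 0ℓ →
    ∀ (k : ℕ) (Δ : ℕ → ℕ → Fin k) → Symmetric Δ → SurjectiveColouring Δ →
    ∀ (n : ℕ) → 1 ≤ n → (n C 2) + 1 ≤ k →
    ∃[ X ] Homogeneous Δ n X
theorem6 em k Δ Δ-sym surj n@(suc i) 1≤n many
  -- Starting from all of ℕ, the edges to the endpoints are made uniform first; this persists in the
  -- subset H that Ramsey's theorem then selects.
  with Y , _ , Y-inf , mono ← refine em Δ Δ-sym (endpoints surj) (λ m → m , ≤-refl , tt)
  with H , H⊆Y , H-inf , h , H-colour ← ramsey em Δ Δ-sym Y-inf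
  with W , m , _ , n≤m , ch , few ←
    chain-with-few-colours em Δ Δ-sym H H-inf h H-colour i (endpoints surj)
      (λ w∈ → let c , eq = mono w∈ in c , eq ∘ H⊆Y)
      -- All k colours occur among the endpoints, so the assumed lower bound on k becomes one on
      -- their count.
      (≤-trans (≤-trans (≤-reflexive (+-comm 1 _)) many)
        (size-full em _ (Colours-mono em Δ Δ-sym inj₂ ∘ endpoints-colours surj)))
  with A , A⊆ , chA ← truncate em Δ Δ-sym 1≤n n≤m ch =
  X , nonempty ,
  (λ i j _ _ _ _ → disjoint) ,
  (infinite , coloured) ,
  increasing , new ,
  -- The exact number of colours is the witness for (5). It obeys the bound because the truncated
  -- union lies inside H ∪ W.
  size em (Colours Δ (bar X n)) ,
  ≤-trans (size-mono em (Colours Δ (bar X n)) (Colours Δ (H ∪ (_∈ W)))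
      (Colours-mono em Δ Δ-sym (A⊆ ∘ proj₁ cover)))
    (≤-trans few (≤-reflexive (+-comm 1 _))) ,
  hasSize em _
  where
  open Layers (layers em Δ Δ-sym chA)
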